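{- Let $k$ be a finite field with $q$ elements, and let $m,n$ be integers with $0\le 2m\le n+1$. Then the characteristic function of $H_m$, as a function on $W_n$, equals $$\sum_{K\in\mathbf{P}_m}\chi_K\;-\;q\sum_{K\in\mathbf{P}_{m-1}}\chi_K,$$ where $\chi_K$ is the characteristic function of the set $K\subseteq W_n$, and the second sum is interpreted as zero when $m=0$.
   Context: For an integer $n\ge -1$, $V_n$ is the $k$-vector space of homogeneous polynomials of degree $n$ (including $0$) in $k[Y,Z]$, with $V_{ -1}=\{0\}$; $W_n$ is the dual of $V_n$, identified with the space of sequences $x=(x_0,\ldots,x_n)\in k^{n+1}$ by letting $x$ act as $\sum_{i=0}^n a_iY^iZ^{n-i}\mapsto\sum_{i=0}^n a_ix_i$. For $d\ge 0$, $n+1\ge d$ and $Q\in V_d$, $M_n(Q):V_{n-d}\to V_n$ is the linear map $P\mapsto PQ$, and $M_n^*(Q):W_n\to W_{n-d}$ is its adjoint; explicitly, if $Q=\sum_{i=0}^d a_iY^iZ^{d-i}$, the $j$-th term of $M_n^*(Q)(x)$ is $\sum_{i=0}^d a_ix_{i+j}$ for $0\le j\le n-d$. $H_m\subseteq W_n$ is the set of sequences $(x_0,\ldots,x_n)$ for which there exist $a_0,\ldots,a_m\in k$, not all zero, such that $\sum_{i=0}^m a_ix_{i+j}=0$ for each $j=0,1,\ldots,n-m$. $\mathbf{P}_d$ is the set of all subspaces of $W_n$ of the form $\ker M_n^*(Q)$ for some nonzero $Q\in V_d$ (each subspace counted once). -}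

module Defs where

open import Algebra.Bundles using (CommutativeRing)
open import Algebra.Definitions using (Invertible)
import Algebra.Properties.Semiring.Sum as Sum
open import Data.Bool.Base using (if_then_else_)
open import Data.Fin.Base as Fin using (Fin; toℕ; fromℕ<)
import Data.Fin.Properties as Fin
open import Data.Integer.Base as ℤ using (ℤ; 0ℤ; 1ℤ)
open import Data.List.Base using (List; []; _∷_; [_]; map; foldr; allFin; deduplicate; cartesianProductWith)
open import Data.List.Membership.Setoid using () renaming (_∈_ to Member)
import Data.List.Membership.Setoid.Properties as Membership
open import Data.List.Membership.Propositional.Properties using (∈-allFin)
open import Data.List.Relation.Unary.All as All using (all?)
open import Data.List.Relation.Unary.Any as Any using (any?; here; there)
open import Data.List.Relation.Unary.Enumerates.Setoid using (IsEnumeration)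
import Data.List.Relation.Unary.Enumerates.Setoid.Properties as Enumerates
open import Data.List.Relation.Unary.Unique.Setoid using (Unique)
open import Data.List.Relation.Unary.Unique.DecSetoid.Properties using (deduplicate-!)
open import Data.Nat.Base as ℕ using (ℕ; zero; suc; _∸_)
import Data.Nat.Properties as ℕ
open import Data.Product.Base using (∃; ∃-syntax; _×_; _,_; proj₁; proj₂)
open import Data.Vec.Functional as Vector using (Vector)
import Data.Vec.Functional.Relation.Binary.Equality.Setoid as VectorEquality
import Data.Vec.Functional.Relation.Binary.Pointwise.Properties as Pointwise
open import Function.Base using (_∘_)
open import Function.Bundles using (Inverse)
open import Function.Properties.Inverse using (Inverse⇒Injection; Inverse⇒Surjection)
import Function.Construct.Symmetry as Symmetry
open import Level using (Level; _⊔_) renaming (suc to lsuc)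
open import Relation.Binary.Bundles using (Setoid; DecSetoid)
import Relation.Binary.Definitions as B
open import Relation.Binary.PropositionalEquality as ≡ using (_≡_)
open import Relation.Nullary.Decidable using (Dec; yes; no; does; map′; via-injection; ¬?; _×-dec_; _→-dec_)
open import Relation.Nullary.Negation using (¬_; contradiction)
open import Relation.Unary using (Pred; Decidable; _≐_; _⊆_)
open import Relation.Unary.Properties using (≐-refl; ≐-sym; ≐-trans)

-- Since equality on a finite field is decidable, the usual definition of a
-- field is used rather than one based on an apartness relation.

record FiniteField (c ℓ : Level) (q : ℕ) : Set (lsuc (c ⊔ ℓ)) where
  field
    commutativeRing : CommutativeRing c ℓ

  open CommutativeRing commutativeRing public

  field
    1≉0         : 1# ≉ 0#
    invertible  : ∀ x → x ≉ 0# → Invertible _≈_ 1# _*_ x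
    enumeration : Inverse setoid (≡.setoid (Fin q))

χ : ∀ {a p} {A : Set a} {P : Pred A p} → Decidable P → A → ℤ
χ P? x = if does (P? x) then 1ℤ else 0ℤ

module Sequences {c ℓ : Level} {q : ℕ} (k : FiniteField c ℓ q) where

  open FiniteField k
  open Sum semiring
  open VectorEquality setoid public using (_≋_; ≋-setoid)

  -- Both spaces are indexed by their dimension n + 1 rather than by n, so that
  -- n = -1 is covered: V (suc d) is the space of forms of degree d.  Entry i of
  -- an element of V is the coefficient of Y^i Z^(n-i).

  V W : ℕ → Set c
  V n+1 = Vector Carrier n+1
  W n+1 = Vector Carrier n+1

  0ᵛ : ∀ {N} → Vector Carrier N
  0ᵛ _ = 0#

  ⟨_,_⟩ : ∀ {N} → W N → V N → Carrier
  ⟨_,_⟩ {N} x P = ∑[ i < N ] (P i * x i)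

  ⊕-bound : ∀ {N d i j} → i ℕ.< suc d → j ℕ.< N ∸ d → i ℕ.+ j ℕ.< N
  ⊕-bound {N} {d} {i} {j} i≤d j<N∸d = begin-strict
    i ℕ.+ j         <⟨ ℕ.+-mono-≤-< (ℕ.s≤s⁻¹ i≤d) j<N∸d ⟩
    d ℕ.+ (N ∸ d)   ≡⟨ ℕ.m+[n∸m]≡n (ℕ.<⇒≤ (ℕ.m∸n≢0⇒n<m {N} {d} (ℕ.m<n⇒n≢0 j<N∸d))) ⟩
    N               ∎
    where open ℕ.≤-Reasoning

  _⊕_ : ∀ {N d} → Fin (suc d) → Fin (N ∸ d) → Fin N
  i ⊕ j = fromℕ< (⊕-bound (Fin.toℕ<n i) (Fin.toℕ<n j))

  -- When d > n + 1, which the mathematics excludes, N ∸ d is 0 and the maps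
  -- below start or end in the zero space.

  M : ∀ {N d} → V (suc d) → V (N ∸ d) → V N
  M {N} {d} Q P l =
    ∑[ i < suc d ] ∑[ j < N ∸ d ] (if does (i ⊕ j Fin.≟ l) then Q i * P j else 0#)

  M* : ∀ N {d} → V (suc d) → W N → W (N ∸ d)
  M* N {d} Q x j = ∑[ i < suc d ] (Q i * x (i ⊕ j))

  private
    select : ∀ {N} (l₀ : Fin N) (a : Carrier) (x : W N) →
             ∑[ l < N ] ((if does (l₀ Fin.≟ l) then a else 0#) * x l) ≈ a * x l₀
    select {suc N} Fin.zero a x = trans
      (+-congˡ (trans (sum-cong-≋ {N} λ _ → zeroˡ _) (sum-replicate-zero N)))
      (+-identityʳ _)
    select {suc N} (Fin.suc l₀) a x = trans
      (+-cong (zeroˡ _) (select l₀ a (x ∘ Fin.suc))) (+-identityˡ _)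

  M*-adjoint : ∀ {N d} (Q : V (suc d)) (P : V (N ∸ d)) (x : W N) →
               ⟨ M* N Q x , P ⟩ ≈ ⟨ x , M Q P ⟩
  M*-adjoint {N} {d} Q P x = sym (begin
    ∑[ l < N ] (M Q P l * x l)
      ≈⟨ ∑-cong (λ l → trans
           (*-distribʳ-sum (x l) (λ i → ∑[ j < N ∸ d ] term i j l))
           (∑-cong (λ i → *-distribʳ-sum (x l) (λ j → term i j l)))) ⟩
    ∑[ l < N ] ∑[ i < suc d ] ∑[ j < N ∸ d ] (term i j l * x l)
      ≈⟨ ∑-comm (λ l i → ∑[ j < N ∸ d ] (term i j l * x l)) ⟩
    ∑[ i < suc d ] ∑[ l < N ] ∑[ j < N ∸ d ] (term i j l * x l)
      ≈⟨ ∑-cong (λ i → ∑-comm (λ l j → term i j l * x l)) ⟩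
    ∑[ i < suc d ] ∑[ j < N ∸ d ] ∑[ l < N ] (term i j l * x l)
      ≈⟨ ∑-cong (λ i → ∑-cong (λ j → select (i ⊕ j) (Q i * P j) x)) ⟩
    ∑[ i < suc d ] ∑[ j < N ∸ d ] ((Q i * P j) * x (i ⊕ j))
      ≈⟨ ∑-comm (λ i j → (Q i * P j) * x (i ⊕ j)) ⟩
    ∑[ j < N ∸ d ] ∑[ i < suc d ] ((Q i * P j) * x (i ⊕ j))
      ≈⟨ ∑-cong (λ j → trans
           (∑-cong (λ i → trans (*-congʳ (*-comm (Q i) (P j))) (*-assoc (P j) (Q i) (x (i ⊕ j)))))
           (sym (*-distribˡ-sum (P j) (λ i → Q i * x (i ⊕ j))))) ⟩
    ∑[ j < N ∸ d ] (P j * M* N Q x j) ∎)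
    where
    open import Relation.Binary.Reasoning.Setoid setoid
    term : Fin (suc d) → Fin (N ∸ d) → Fin N → Carrier
    term i j l = if does (i ⊕ j Fin.≟ l) then Q i * P j else 0#
    ∑-cong : ∀ {n} {f g : Fin n → Carrier} → (∀ i → f i ≈ g i) → sum f ≈ sum g
    ∑-cong {n} = sum-cong-≋ {n}

  ker : ∀ N {d} → V (suc d) → Pred (W N) ℓ
  ker N Q x = M* N Q x ≋ 0ᵛ

  H : ∀ {N} → ℕ → Pred (W N) (c ⊔ ℓ)
  H {N} m x = ∃[ a ] ¬ a ≋ 0ᵛ × (∀ (j : Fin (N ∸ m)) → ∑[ i < suc m ] (a i * x (i ⊕ j)) ≈ 0#)

  _∈𝐏_ : ∀ {N} → Pred (W N) ℓ → ℕ → Set (c ⊔ ℓ)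
  _∈𝐏_ {N} K d = ∃[ Q ] ¬ Q ≋ 0ᵛ {suc d} × K ≐ ker N Q

  infix 4 _≟_

  _≟_ : B.Decidable _≈_
  _≟_ = via-injection (Inverse⇒Injection enumeration) Fin._≟_

  _≋?_ : ∀ {N} → B.Decidable (_≋_ {N})
  _≋?_ = Pointwise.decidable _≟_

  elements : List Carrier
  elements = map (Inverse.from enumeration) (allFin q)

  elements-enumerate : IsEnumeration setoid elements
  elements-enumerate = Enumerates.map⁺ (≡.setoid (Fin q)) setoid
    (Inverse⇒Surjection (Symmetry.inverse enumeration)) ∈-allFin

  vectors : ∀ N → List (Vector Carrier N)
  vectors zero    = [ 0ᵛ ]
  vectors (suc N) = cartesianProductWith Vector._∷_ elements (vectors N)

  vectors-enumerate : ∀ N → IsEnumeration (≋-setoid N) (vectors N)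
  vectors-enumerate zero    v = here λ ()
  vectors-enumerate (suc N) v = Membership.∈-resp-≈ (≋-setoid (suc N))
    {y = v} (λ where Fin.zero → refl ; (Fin.suc i) → refl)
    (Membership.∈-cartesianProductWith⁺ setoid (≋-setoid N) (≋-setoid (suc N))
      {f = Vector._∷_} (λ a≈b v≋w → λ where Fin.zero → a≈b ; (Fin.suc i) → v≋w i)
      (elements-enumerate (Vector.head v)) (vectors-enumerate N (Vector.tail v)))

  ∃? : ∀ {p N} {P : Pred (Vector Carrier N) p} → P B.Respects _≋_ → Decidable P → Dec (∃ P)
  ∃? {N = N} resp P? = map′ Any.satisfied
    (λ (v , p) → Any.map (λ v≋w → resp v≋w p) (vectors-enumerate N v))
    (any? P? (vectors N))

  ∀? : ∀ {p N} {P : Pred (Vector Carrier N) p} → P B.Respects _≋_ → Decidable P → Dec (∀ v → P v)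
  ∀? {N = N} resp P? = map′
    (λ all v → All.lookupₛ (≋-setoid N) resp all (vectors-enumerate N v))
    (λ f → All.universal f (vectors N))
    (all? P? (vectors N))

  M*-cong : ∀ {N d} {Q Q′ : V (suc d)} {x x′ : W N} → Q ≋ Q′ → x ≋ x′ → M* N Q x ≋ M* N Q′ x′
  M*-cong {d = d} Q≋Q′ x≋x′ j = sum-cong-≋ {suc d} λ i → *-cong (Q≋Q′ i) (x≋x′ (i ⊕ j))

  ker-resp : ∀ {N d} (Q : V (suc d)) → ker N Q B.Respects _≋_
  ker-resp {N} Q x≋y x∈ j = trans (M*-cong {N} {Q = Q} (λ _ → refl) (λ i → sym (x≋y i)) j) (x∈ j)

  ker-⊆-cong : ∀ {N d} {Q Q′ : V (suc d)} → Q ≋ Q′ → ker N Q ⊆ ker N Q′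
  ker-⊆-cong {N} Q≋Q′ {x} x∈ j =
    trans (M*-cong {N} {x = x} (λ i → sym (Q≋Q′ i)) (λ _ → refl) j) (x∈ j)

  ker-cong : ∀ {N d} {Q Q′ : V (suc d)} → Q ≋ Q′ → ker N Q ≐ ker N Q′
  ker-cong {Q = Q} {Q′} Q≋Q′ =
    (λ {x} → ker-⊆-cong {Q = Q} {Q′} Q≋Q′ {x}) ,
    (λ {x} → ker-⊆-cong {Q = Q′} {Q} (λ i → sym (Q≋Q′ i)) {x})

  ker? : ∀ {N d} (Q : V (suc d)) → Decidable (ker N Q)
  ker? {N} Q x = M* N Q x ≋? 0ᵛ

  H? : ∀ {N} m → Decidable (H {N} m)
  H? {N} m x = ∃?
    (λ {a} {b} a≋b (a≢0 , x∈) →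
      (λ b≋0 → a≢0 (λ i → trans (a≋b i) (b≋0 i))) , ker-⊆-cong {Q = a} {b} a≋b {x} x∈)
    (λ a → ¬? (a ≋? 0ᵛ) ×-dec ker? {N} a x)

  ker-⊆? : ∀ N {d} (Q Q′ : V (suc d)) → Dec (ker N Q ⊆ ker N Q′)
  ker-⊆? N Q Q′ = map′ (λ f {x} → f x) (λ f x → f {x})
    (∀? (λ x≋y f y∈ → ker-resp Q′ x≋y (f (ker-resp Q (λ i → sym (x≋y i)) y∈)))
        (λ x → ker? {N} Q x →-dec ker? {N} Q′ x))

  -- Elements are subspaces; Q is only a witness, ignored by the equality, so
  -- proportional forms give one and the same element.

  𝐏 : ℕ → ℕ → DecSetoid (c ⊔ lsuc ℓ) (c ⊔ ℓ)
  𝐏 N d = record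
    { Carrier = ∃[ K ] _∈𝐏_ {N} K d
    ; _≈_     = λ (K , _) (K′ , _) → K ≐ K′
    ; isDecEquivalence = record
      { isEquivalence = record { refl = ≐-refl ; sym = ≐-sym ; trans = ≐-trans }
      ; _≟_ = λ (K , Q , _ , K≐) (K′ , Q′ , _ , K′≐) →
          map′ (λ Q≐Q′ → ≐-trans K≐ (≐-trans Q≐Q′ (≐-sym K′≐)))
               (λ K≐K′ → ≐-trans (≐-sym K≐) (≐-trans K≐K′ K′≐))
               (ker-⊆? N Q Q′ ×-dec ker-⊆? N Q′ Q)
      }
    }

  module 𝐏 {N d : ℕ} = DecSetoid (𝐏 N d)

  ∈? : ∀ {N d} (K : 𝐏.Carrier {N} {d}) → Decidable (proj₁ K)
  ∈? {N} (K , Q , _ , K⊆ , ⊆K) x = map′ ⊆K K⊆ (ker? {N} Q x)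

  kernels : ∀ {N d} → List (V (suc d)) → List (𝐏.Carrier {N} {d})
  kernels []       = []
  kernels {N} (Q ∷ Qs) with Q ≋? 0ᵛ
  ... | yes _  = kernels Qs
  ... | no Q≢0 = (ker N Q , Q , Q≢0 , ≐-refl) ∷ kernels Qs

  kernels-complete : ∀ {N d} Qs ((K , Q , Q≢0 , K≐) : 𝐏.Carrier {N} {d}) →
    Member (≋-setoid (suc d)) Q Qs → Member (𝐏.setoid {N} {d}) (K , Q , Q≢0 , K≐) (kernels Qs)
  kernels-complete (Q′ ∷ Qs) K∈𝐏@(K , Q , Q≢0 , K≐) Q∈ with Q′ ≋? 0ᵛ | Q∈
  ... | yes Q′≋0 | here Q≋Q′ = contradiction (λ i → trans (Q≋Q′ i) (Q′≋0 i)) Q≢0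
  ... | yes _    | there Q∈′ = kernels-complete Qs K∈𝐏 Q∈′
  ... | no _     | here Q≋Q′ = here (≐-trans K≐ (ker-cong {Q = Q} {Q′} Q≋Q′))
  ... | no _     | there Q∈′ = there (kernels-complete Qs K∈𝐏 Q∈′)

  members : ∀ N d → List (𝐏.Carrier {N} {d})
  members N d = deduplicate (𝐏._≟_ {N} {d}) (kernels (vectors (suc d)))

  members-unique : ∀ N d → Unique 𝐏.setoid (members N d)
  members-unique N d = deduplicate-! (𝐏 N d) (kernels (vectors (suc d)))

  members-enumerate : ∀ N d → IsEnumeration 𝐏.setoid (members N d)
  members-enumerate N d = Enumerates.deduplicate⁺ (𝐏 N d)
    (λ K∈𝐏@(_ , Q , _) → kernels-complete (vectors (suc d)) K∈𝐏 (vectors-enumerate (suc d) Q))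

  -- Sums of χ K over all K in 𝐏 d, respectively 𝐏 (d - 1).

  ∑χ : ∀ {N} → ℕ → W N → ℤ
  ∑χ {N} d x = foldr ℤ._+_ 0ℤ (map (λ K → χ (∈? {N} {d} K) x) (members N d))

  ∑χ-pred : ∀ {N} → ℕ → W N → ℤ
  ∑χ-pred zero    x = 0ℤ
  ∑χ-pred (suc d) x = ∑χ d x

{-# OPTIONS --safe #-}

-- Fix x and let A d be the space of forms Q of degree d with x in the kernel of
-- M*(Q).  Since 2m ≤ n + 1, forms of degree d ≤ m with the same kernel are
-- proportional, so the sum over 𝐏 d, evaluated at x, counts the points of the
-- projective space of A d.  If A m ≠ 0, let f be the largest exponent of Y
-- occurring in A m.  Then the forms in A m without Y^f Z^(m-f) are exactly
-- Z · A (m - 1); so A (m - 1) is a hyperplane of A m, and a projective space has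
-- 1 + q p points if p is the number of points of a hyperplane.

module Submission where

open import Defs
import Algebra.Properties.CommutativeSemigroup as CommutativeSemigroupProperties
import Algebra.Properties.Group as GroupProperties
import Algebra.Properties.Ring as RingProperties
import Algebra.Properties.Semiring.Sum as Sum
open import Data.Bool.Base using (true; false; if_then_else_)
open import Data.Fin.Base as Fin using (Fin; toℕ; fromℕ<)
import Data.Fin.Properties as Fin
open import Data.Fin.Relation.Unary.Top using (view; ‵fromℕ; ‵inject₁)
open import Data.Integer.Base as ℤ using (ℤ; +_; _-_; 0ℤ; 1ℤ) renaming (_*_ to _*ℤ_)
import Data.Integer.Properties as ℤ
open import Data.List.Base using (List; []; _∷_; map; foldr; filter; length; lookup)
import Data.List.Membership.Propositional.Properties as Propositional
open import Data.List.Membership.Setoid.Properties using (∈-filter⁺; ∈-filter⁻; ∈-lookup)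
open import Data.List.Relation.Unary.All as All using ()
open import Data.List.Relation.Unary.AllPairs using (_∷_)
open import Data.List.Relation.Unary.Any as Any using ()
open import Data.List.Relation.Unary.Any.Properties using (lookup-index)
open import Data.List.Relation.Unary.Unique.Setoid using (Unique)
import Data.List.Relation.Unary.Unique.Setoid.Properties as Unique
open import Data.Nat.Base as ℕ using (ℕ; zero; suc; _∸_; _*_; _≤_)
import Data.Nat.Properties as ℕ
open import Data.Product.Base using (∃; ∃-syntax; _×_; _,_; proj₁; proj₂; uncurry)
open import Data.Sum.Base using (_⊎_; inj₁; inj₂)
open import Data.Vec.Functional as Vector using (Vector)
open import Function.Base using (_∘_; case_of_)
open import Function.Bundles using (Inverse)
open import Level using (_⊔_)
open import Relation.Binary.Bundles using (Setoid)
open import Relation.Binary.Definitions as B using (tri<; tri≈; tri>)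
open import Relation.Binary.PropositionalEquality as ≡ using (_≡_; _≢_)
open import Relation.Nullary.Decidable
  using (Dec; yes; no; does; ¬?; _×-dec_; dec-true; dec-false; decidable-stable)
open import Relation.Nullary.Negation using (¬_; contradiction)
open import Relation.Unary using (Pred; Decidable; _≐_; _⊆_)
open import Relation.Unary.Properties using (≐-refl; ≐-sym; ≐-trans)

-- Lists without repetition, and the indicator as a difference of counts

unique-lookup : ∀ {a ℓ} (S : Setoid a ℓ) → let open Setoid S in
                ∀ {xs} → Unique S xs → ∀ i j → lookup xs i ≈ lookup xs j → i ≡ j
unique-lookup S (_ ∷ _)   Fin.zero    Fin.zero    _  = ≡.refl
unique-lookup S (x≉ ∷ _)  Fin.zero    (Fin.suc j) eq =
  contradiction eq (All.lookup x≉ (Propositional.∈-lookup j))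
unique-lookup S (x≉ ∷ _)  (Fin.suc i) Fin.zero    eq =
  contradiction (Setoid.sym S eq) (All.lookup x≉ (Propositional.∈-lookup i))
unique-lookup S (_ ∷ xs!) (Fin.suc i) (Fin.suc j) eq =
  ≡.cong Fin.suc (unique-lookup S xs! i j eq)

-- Reduces the formula at one sequence to two equations in ℕ, one for sequences in `H m` and one for
-- the others.
indicator≡difference : ∀ {a} {A : Set a} (A? : Dec A) {s s′ : ℤ} {q n n′ : ℕ} → s ≡ + n → s′ ≡ + n′ →
  (A → n ≡ suc (q * n′)) → (¬ A → n ≡ 0 × n′ ≡ 0) →
  (if does A? then 1ℤ else 0ℤ) ≡ s - (+ q) *ℤ s′
indicator≡difference (yes a) {q = q} {n′ = n′} ≡.refl ≡.refl n≡1+qn′ _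
  rewrite n≡1+qn′ a | ≡.sym (ℤ.pos-* q n′) = ≡.sym (≡.trans
    (ℤ.+-assoc 1ℤ (+ (q * n′)) (ℤ.- + (q * n′)))
    (≡.cong (λ z → 1ℤ ℤ.+ z) (ℤ.+-inverseʳ (+ (q * n′)))))
indicator≡difference (no ¬a) {q = q} ≡.refl ≡.refl _ n≡0×n′≡0
  with ≡.refl , ≡.refl ← n≡0×n′≡0 ¬a rewrite ℤ.*-zeroʳ (+ q) = ≡.refl

module Forms {c ℓ q} (k : FiniteField c ℓ q) where

  open FiniteField k hiding (_-_) renaming (_*_ to _·_)
  open Sequences k
  open Sum semiring
  open CommutativeSemigroupProperties *-commutativeSemigroup using (x∙yz≈y∙xz)
  open CommutativeSemigroupProperties ℕ.+-commutativeSemigroup using ()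
    renaming (x∙yz≈y∙xz to x+[y+z]≡y+[x+z])
  open GroupProperties +-group using (x∙y⁻¹≈ε⇒x≈y; ∙-cancelʳ)
  open RingProperties ring using (-‿distribˡ-*)
  open import Relation.Binary.Reasoning.Setoid setoid

  -- Arithmetic in the field and finite sums

  inverse : ∀ {a} → a ≉ 0# → ∃[ b ] b · a ≈ 1#
  inverse {a} a≉0 with b , ba≈1 , _ ← invertible a a≉0 = b , ba≈1

  cancel : ∀ {a b x} → b · a ≈ 1# → b · (a · x) ≈ x
  cancel ba≈1 = trans (sym (*-assoc _ _ _)) (trans (*-congʳ ba≈1) (*-identityˡ _))

  integral : ∀ {a x} → a ≉ 0# → a · x ≈ 0# → x ≈ 0#
  integral a≉0 ax≈0 with b , ba≈1 ← inverse a≉0 =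
    trans (sym (cancel ba≈1)) (trans (*-congˡ ax≈0) (zeroʳ b))

  x+-y*z≈0 : ∀ {x y z} → x ≈ y · z → x + - y · z ≈ 0#
  x+-y*z≈0 {x} {y} {z} x≈yz =
    trans (+-cong x≈yz (sym (-‿distribˡ-* y z))) (-‿inverseʳ (y · z))

  x+-y*z≈0⇒x≈y*z : ∀ {x y z} → x + - y · z ≈ 0# → x ≈ y · z
  x+-y*z≈0⇒x≈y*z {x} {y} {z} eq =
    x∙y⁻¹≈ε⇒x≈y x (y · z) (trans (+-congˡ (-‿distribˡ-* y z)) eq)

  x+y*0≈x : ∀ {x z} y → z ≈ 0# → x + y · z ≈ x
  x+y*0≈x y z≈0 = trans (+-congˡ (trans (*-congˡ z≈0) (zeroʳ y))) (+-identityʳ _)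

  sum-cong : ∀ {D} {s t : Vector Carrier D} → (∀ i → s i ≈ t i) → sum s ≈ sum t
  sum-cong {D} = sum-cong-≋ {D}

  sum-zero : ∀ {D} {t : Vector Carrier D} → (∀ i → t i ≈ 0#) → sum t ≈ 0#
  sum-zero {D} t≈0 = trans (sum-cong t≈0) (sum-replicate-zero D)

  sum-single : ∀ {D} (t : Vector Carrier D) i → (∀ a → a ≢ i → t a ≈ 0#) → sum t ≈ t i
  sum-single {suc D} t i t≈0 = trans (sum-remove {i = i} t)
    (trans (+-congˡ (sum-zero λ a → t≈0 _ (Fin.punchInᵢ≢i i a))) (+-identityʳ (t i)))

  sum-linear : ∀ {D} (s t : Vector Carrier D) a →
               sum (λ i → s i + a · t i) ≈ sum s + a · sum t
  sum-linear {D} s t a = trans (∑-distrib-+ s (λ i → a · t i)) (+-congˡ (sym (*-distribˡ-sum a t)))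

  -- Forms acting on sequences indexed by ℕ

  infixl 7 _⋆_
  infixl 6 _+[_]_

  -- With Y acting as the shift and Z as the identity, this is the action of a form on sequences.
  -- Indexing by ℕ removes the bounds of `⊕`, so that forms of different degrees act on the same
  -- sequence and can be composed.
  _⋆_ : ∀ {D} → Vector Carrier D → (ℕ → Carrier) → ℕ → Carrier
  (Q ⋆ y) j = sum (λ i → Q i · y (toℕ i ℕ.+ j))

  _+[_]_ : ∀ {D} → Vector Carrier D → Carrier → Vector Carrier D → Vector Carrier D
  (P +[ a ] Q) i = P i + a · Q i

  ⋆-linearˡ : ∀ {D} (P Q : Vector Carrier D) a y j →
              ((P +[ a ] Q) ⋆ y) j ≈ (P ⋆ y) j + a · (Q ⋆ y) j
  ⋆-linearˡ {D} P Q a y j = trans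
    (sum-cong {D} λ i → trans (distribʳ (y _) (P i) (a · Q i)) (+-congˡ (*-assoc a (Q i) (y _))))
    (sum-linear (λ i → P i · y (toℕ i ℕ.+ j)) (λ i → Q i · y (toℕ i ℕ.+ j)) a)

  ⋆-linearʳ : ∀ {D} (Q : Vector Carrier D) y a z j →
              (Q ⋆ (λ l → y l + a · z l)) j ≈ (Q ⋆ y) j + a · (Q ⋆ z) j
  ⋆-linearʳ {D} Q y a z j = trans
    (sum-cong {D} λ i →
      trans (distribˡ (Q i) (y _) (a · z _)) (+-congˡ (x∙yz≈y∙xz (Q i) a (z _))))
    (sum-linear (λ i → Q i · y (toℕ i ℕ.+ j)) (λ i → Q i · z (toℕ i ℕ.+ j)) a)

  -- Both sides are the action of the product `P Q`; exchanging the two sums avoids constructing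
  -- that product.
  ⋆-comm : ∀ {D E} (P : Vector Carrier D) (Q : Vector Carrier E) y j →
           (P ⋆ (Q ⋆ y)) j ≈ (Q ⋆ (P ⋆ y)) j
  ⋆-comm {D} {E} P Q y j = begin
    sum (λ i → P i · sum (λ i′ → Q i′ · y (toℕ i′ ℕ.+ (toℕ i ℕ.+ j))))
      ≈⟨ sum-cong (λ i → *-distribˡ-sum (P i) (λ i′ → Q i′ · y (toℕ i′ ℕ.+ (toℕ i ℕ.+ j)))) ⟩
    sum (λ i → sum (λ i′ → P i · (Q i′ · y (toℕ i′ ℕ.+ (toℕ i ℕ.+ j)))))
      ≈⟨ ∑-comm (λ i i′ → P i · (Q i′ · y (toℕ i′ ℕ.+ (toℕ i ℕ.+ j)))) ⟩
    sum (λ i′ → sum (λ i → P i · (Q i′ · y (toℕ i′ ℕ.+ (toℕ i ℕ.+ j)))))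
      ≈⟨ sum-cong (λ i′ → sum-cong (λ i → swap i i′)) ⟩
    sum (λ i′ → sum (λ i → Q i′ · (P i · y (toℕ i ℕ.+ (toℕ i′ ℕ.+ j)))))
      ≈⟨ sum-cong (λ i′ → *-distribˡ-sum (Q i′) (λ i → P i · y (toℕ i ℕ.+ (toℕ i′ ℕ.+ j)))) ⟨
    sum (λ i′ → Q i′ · sum (λ i → P i · y (toℕ i ℕ.+ (toℕ i′ ℕ.+ j)))) ∎
    where
    swap : ∀ (i : Fin D) (i′ : Fin E) →
           P i · (Q i′ · y (toℕ i′ ℕ.+ (toℕ i ℕ.+ j))) ≈ Q i′ · (P i · y (toℕ i ℕ.+ (toℕ i′ ℕ.+ j)))
    swap i i′ rewrite x+[y+z]≡y+[x+z] (toℕ i′) (toℕ i) j = x∙yz≈y∙xz (P i) (Q i′) _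

  δ : ℕ → ℕ → Carrier
  δ l a = if does (l ℕ.≟ a) then 1# else 0#

  δ-diagonal : ∀ l → δ l l ≈ 1#
  δ-diagonal l rewrite dec-true (l ℕ.≟ l) ≡.refl = refl

  δ-off : ∀ {l a} → l ≢ a → δ l a ≈ 0#
  δ-off {l} {a} l≢a rewrite dec-false (l ℕ.≟ a) l≢a = refl

  ⋆-δ : ∀ {D} (Q : Vector Carrier D) i j → (Q ⋆ δ (toℕ i ℕ.+ j)) j ≈ Q i
  ⋆-δ Q i j = trans
    (sum-single (λ a → Q a · δ (toℕ i ℕ.+ j) (toℕ a ℕ.+ j)) i λ a a≢i →
      trans (*-congˡ (δ-off λ eq → a≢i (Fin.toℕ-injective (≡.sym (ℕ.+-cancelʳ-≡ j _ _ eq)))))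
            (zeroʳ (Q a)))
    (trans (*-congˡ (δ-diagonal (toℕ i ℕ.+ j))) (*-identityʳ (Q i)))

  ⋆-δ-zero : ∀ {D} (Q : Vector Carrier D) l j → (∀ i → l ≡ toℕ i ℕ.+ j → Q i ≈ 0#) →
             (Q ⋆ δ l) j ≈ 0#
  ⋆-δ-zero Q l j Q≈0 = sum-zero go
    where
    go : ∀ i → Q i · δ l (toℕ i ℕ.+ j) ≈ 0#
    go i with l ℕ.≟ toℕ i ℕ.+ j
    ... | yes eq = trans (*-congʳ (Q≈0 i eq)) (zeroˡ _)
    ... | no neq = trans (*-congˡ (δ-off neq)) (zeroʳ (Q i))

  -- Leading exponents and linear recurrences

  Leading : ∀ {D} → Vector Carrier D → Fin D → Set ℓ
  Leading Q f = Q f ≉ 0# × (∀ i → f Fin.< i → Q i ≈ 0#)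

  maximal : ∀ {p D} {P : Pred (Fin D) p} → Decidable P → ∃ P →
            ∃[ f ] P f × (∀ i → f Fin.< i → ¬ P i)
  maximal {D = suc D} P? (i , Pi) with Fin.any? (P? ∘ Fin.suc) | i
  ... | yes ∃P | _ with f , Pf , f-max ← maximal (P? ∘ Fin.suc) ∃P =
    Fin.suc f , Pf , λ where (Fin.suc i) f<i → f-max i (ℕ.s<s⁻¹ f<i)
  ... | no ∄P  | Fin.zero  = Fin.zero , Pi , λ where (Fin.suc i) _ Pi → ∄P (i , Pi)
  ... | no ∄P  | Fin.suc i = contradiction (i , Pi) ∄P

  nonzero-entry : ∀ {D} (Q : Vector Carrier D) → ¬ Q ≋ 0ᵛ → ∃[ i ] Q i ≉ 0#
  nonzero-entry {D} Q = Fin.¬∀⟶∃¬ D (λ i → Q i ≈ 0#) (λ i → Q i ≟ 0#)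

  leading : ∀ {D} (Q : Vector Carrier D) → ¬ Q ≋ 0ᵛ → ∃ (Leading Q)
  leading Q Q≢0 with f , Qf≉0 , f-max ← maximal (λ i → ¬? (Q i ≟ 0#)) (nonzero-entry Q Q≢0) =
    f , Qf≉0 , λ i f<i → decidable-stable (Q i ≟ 0#) (f-max i f<i)

  -- As `Q f` is invertible and `Q` vanishes beyond `f`, the equation `(Q ⋆ s) j ≈ 0#` can be solved
  -- for the term `s (f + j)`. Hence the terms below `f` are free, and the conditions are met one
  -- after another.
  recurrent : ∀ {D} (Q : Vector Carrier D) f → Leading Q f → (u : ℕ → Carrier) → ∀ n →
              ∃[ s ] (∀ a → a ℕ.< toℕ f → s a ≈ u a) × (∀ j → j ℕ.< n → (Q ⋆ s) j ≈ 0#)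
  recurrent Q f _ u zero = u , (λ _ _ → refl) , λ _ ()
  recurrent Q f lead@(Qf≉0 , Q≈0) u (suc n)
    with s , s≈u , Qs≈0 ← recurrent Q f lead u n | b , bQf≈1 ← inverse Qf≉0 =
    s′ , (λ a a<f → trans (x+y*0≈x v (δ-off (>⇒≢ a a<f))) (s≈u a a<f)) , Qs′≈0
    where
    -- Adding `v` to the term at `f + n` changes `(Q ⋆ s) n` by `v · Q f`, which cancels it, and
    -- leaves the earlier conditions alone.
    v = - (b · (Q ⋆ s) n)
    s′ : ℕ → Carrier
    s′ l = s l + v · δ (toℕ f ℕ.+ n) l
    >⇒≢ : ∀ a → a ℕ.< toℕ f → toℕ f ℕ.+ n ≢ a
    >⇒≢ a a<f eq = ℕ.<⇒≢ (ℕ.<-≤-trans a<f (ℕ.m≤m+n (toℕ f) n)) (≡.sym eq)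
    beyond : ∀ j → j ℕ.< n → ∀ i → toℕ f ℕ.+ n ≡ toℕ i ℕ.+ j → Q i ≈ 0#
    beyond j j<n i eq = Q≈0 i (ℕ.≰⇒> λ i≤f → ℕ.<⇒≢ (ℕ.+-mono-≤-< i≤f j<n) (≡.sym eq))
    Qs′≈0 : ∀ j → j ℕ.< suc n → (Q ⋆ s′) j ≈ 0#
    Qs′≈0 j j<1+n with ℕ.m<1+n⇒m<n∨m≡n j<1+n
    ... | inj₁ j<n = trans (⋆-linearʳ Q s v (δ (toℕ f ℕ.+ n)) j)
      (trans (x+y*0≈x v (⋆-δ-zero Q (toℕ f ℕ.+ n) j (beyond j j<n))) (Qs≈0 j j<n))
    ... | inj₂ ≡.refl = begin
      (Q ⋆ s′) n                                  ≈⟨ ⋆-linearʳ Q s v (δ (toℕ f ℕ.+ n)) n ⟩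
      (Q ⋆ s) n + v · (Q ⋆ δ (toℕ f ℕ.+ n)) n    ≈⟨ +-congˡ (*-congˡ (⋆-δ Q f n)) ⟩
      (Q ⋆ s) n + v · Q f                         ≈⟨ x+-y*z≈0 (sym (trans (*-assoc _ _ _)
                                                      (trans (*-congˡ (*-comm _ _)) (cancel bQf≈1)))) ⟩
      0#                                          ∎

  -- Passage between finite and infinite sequences

  M*-toℕ : ∀ N {d} (Q : V (suc d)) y j → M* N Q (y ∘ toℕ) j ≈ (Q ⋆ y) (toℕ j)
  M*-toℕ N Q y j = sum-cong λ i →
    *-congˡ {Q i} (reflexive (≡.cong y (Fin.toℕ-fromℕ< (⊕-bound (Fin.toℕ<n i) (Fin.toℕ<n j)))))

  -- Applied to a sequence, it gives an argument for `⋆`; applied to a form, it supplies through its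
  -- default value 0 the vanishing top coefficient in `raise`.
  extend : ∀ {N} → W N → ℕ → Carrier
  extend {N} x l with l ℕ.<? N
  ... | yes l<N = x (fromℕ< l<N)
  ... | no  _   = 0#

  extend-toℕ : ∀ {N} (x : W N) → extend x ∘ toℕ ≋ x
  extend-toℕ {N} x i with toℕ i ℕ.<? N
  ... | yes i<N = reflexive (≡.cong x (Fin.fromℕ<-toℕ i i<N))
  ... | no  i≮N = contradiction (Fin.toℕ<n i) i≮N

  extend-beyond : ∀ {N} (x : W N) {l} → N ≤ l → extend x l ≈ 0#
  extend-beyond {N} x {l} N≤l with l ℕ.<? N
  ... | yes l<N = contradiction l<N (ℕ.≤⇒≯ N≤l)
  ... | no  _   = refl

  ker⇒⋆≈0 : ∀ {N d} {Q : V (suc d)} {y} → ker N Q (y ∘ toℕ) → ∀ j → j ℕ.< N ∸ d → (Q ⋆ y) j ≈ 0#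
  ker⇒⋆≈0 {N} {Q = Q} {y} y∈ j j<N∸d = ≡.subst (λ j → (Q ⋆ y) j ≈ 0#) (Fin.toℕ-fromℕ< j<N∸d)
    (trans (sym (M*-toℕ N Q y (fromℕ< j<N∸d))) (y∈ (fromℕ< j<N∸d)))

  ⋆≈0⇒ker : ∀ {N d} {Q : V (suc d)} {y} → (∀ j → j ℕ.< N ∸ d → (Q ⋆ y) j ≈ 0#) → ker N Q (y ∘ toℕ)
  ⋆≈0⇒ker {N} {Q = Q} {y} Qy≈0 j = trans (M*-toℕ N Q y j) (Qy≈0 (toℕ j) (Fin.toℕ<n j))

  -- Proportional forms and their kernels

  infix 4 _∝_

  _∝_ : ∀ {D} → Vector Carrier D → Vector Carrier D → Set (c ⊔ ℓ)
  P ∝ Q = ∃[ a ] a ≉ 0# × (∀ i → P i ≈ a · Q i)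

  multiple⇒∝ : ∀ {D} {P Q : Vector Carrier D} a → ¬ P ≋ 0ᵛ → (∀ i → P i ≈ a · Q i) → P ∝ Q
  multiple⇒∝ a P≢0 P≈aQ =
    a , (λ a≈0 → P≢0 λ i → trans (P≈aQ i) (trans (*-congʳ a≈0) (zeroˡ _))) , P≈aQ

  ∝-sym : ∀ {D} {P Q : Vector Carrier D} → P ∝ Q → Q ∝ P
  ∝-sym (a , a≉0 , P≈aQ) with b , ba≈1 ← inverse a≉0 =
    b , (λ b≈0 → 1≉0 (trans (sym ba≈1) (trans (*-congʳ b≈0) (zeroˡ a)))) ,
    λ i → trans (sym (cancel ba≈1)) (*-congˡ (sym (P≈aQ i)))

  ∝-trans : ∀ {D} {P Q R : Vector Carrier D} → P ∝ Q → Q ∝ R → P ∝ R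
  ∝-trans (a , a≉0 , P≈aQ) (b , b≉0 , Q≈bR) =
    a · b , (λ ab≈0 → b≉0 (integral a≉0 ab≈0)) ,
    λ i → trans (P≈aQ i) (trans (*-congˡ (Q≈bR i)) (sym (*-assoc a b _)))

  ∝⇒ker⊆ker : ∀ {N d} {P Q : V (suc d)} → P ∝ Q → ker N Q ⊆ ker N P
  ∝⇒ker⊆ker {N} {d} {P} {Q} (a , _ , P≈aQ) {x} x∈ j = begin
    M* N P x j
      ≈⟨ sum-cong (λ i → trans (*-congʳ (P≈aQ i)) (*-assoc a (Q i) (x (i ⊕ j)))) ⟩
    sum (λ i → a · (Q i · x (i ⊕ j)))
      ≈⟨ *-distribˡ-sum a (λ i → Q i · x (i ⊕ j)) ⟨
    a · M* N Q x j
      ≈⟨ *-congˡ (x∈ j) ⟩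
    a · 0#
      ≈⟨ zeroʳ a ⟩
    0# ∎

  ∝⇒ker≐ker : ∀ {N d} {P Q : V (suc d)} → P ∝ Q → ker N P ≐ ker N Q
  ∝⇒ker≐ker {N} {P = P} {Q} P∝Q =
    (λ {x} → ∝⇒ker⊆ker {N} {P = Q} {P} (∝-sym {P = P} {Q} P∝Q) {x}) ,
    (λ {x} → ∝⇒ker⊆ker {N} {P = P} {Q} P∝Q {x})

  -- For f < i the sequence δ (i + J) lies in ker Q and shows P i ≈ 0.  Below f, the
  -- sequences in ker Q take arbitrary values, so R = P - (P f / Q f) Q, which has
  -- degree less than f in Y and annihilates ker Q, is zero.
  ker⊆ker⇒∝ : ∀ {N d} {P Q : V (suc d)} → d ℕ.< N → ¬ P ≋ 0ᵛ → ¬ Q ≋ 0ᵛ →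
              ker N Q ⊆ ker N P → P ∝ Q
  ker⊆ker⇒∝ {N} {d} {P} {Q} d<N P≢0 Q≢0 ker⊆
    with f , lead@(Qf≉0 , Q≈0) ← leading Q Q≢0
    with b , bQf≈1 ← inverse Qf≉0 = multiple⇒∝ {P = P} {Q} a P≢0 P≈aQ
    where
    a = P f · b
    -- `J` is the last position of the `N ∸ d` conditions: `i′ + j ≡ i + J` with `j ≤ J` forces
    -- `i ≤ i′`, and for `f < i` the coefficients of `Q` from `i` on vanish.
    J = N ∸ suc d
    N∸d≡1+J : N ∸ d ≡ suc J
    N∸d≡1+J = ℕ.+-∸-assoc 1 d<N
    annihilates : ∀ y → (∀ j → j ℕ.< N ∸ d → (Q ⋆ y) j ≈ 0#) → ∀ j → j ℕ.< N ∸ d → (P ⋆ y) j ≈ 0#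
    annihilates y Qy≈0 =
      ker⇒⋆≈0 {N} {Q = P} {y} (ker⊆ {y ∘ toℕ} (⋆≈0⇒ker {N} {Q = Q} {y} Qy≈0))
    P≈0 : ∀ i → f Fin.< i → P i ≈ 0#
    P≈0 i f<i = trans (sym (⋆-δ P i J)) (annihilates (δ (toℕ i ℕ.+ J))
      (λ j j<N∸d → ⋆-δ-zero Q (toℕ i ℕ.+ J) j λ i′ eq → Q≈0 i′ (ℕ.<-≤-trans f<i
        (ℕ.≮⇒≥ λ i′<i → ℕ.<⇒≢ (ℕ.+-mono-<-≤ i′<i (ℕ.s≤s⁻¹ (≡.subst (j ℕ.<_) N∸d≡1+J j<N∸d)))
          (≡.sym eq))))
      J (≡.subst (J ℕ.<_) (≡.sym N∸d≡1+J) ℕ.≤-refl))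
    R : V (suc d)
    R = P +[ - a ] Q
    R≈0-beyond : ∀ i → toℕ f ≤ toℕ i → R i ≈ 0#
    R≈0-beyond i f≤i with ℕ.m≤n⇒m<n∨m≡n f≤i
    ... | inj₁ f<i = x+-y*z≈0 (trans (P≈0 i f<i) (sym (trans (*-congˡ (Q≈0 i f<i)) (zeroʳ a))))
    ... | inj₂ f≡i with ≡.refl ← Fin.toℕ-injective {i = f} {i} f≡i =
      x+-y*z≈0 (sym (trans (*-assoc (P f) b (Q f)) (trans (*-congˡ bQf≈1) (*-identityʳ (P f)))))
    0<N∸d : 0 ℕ.< N ∸ d
    0<N∸d = ℕ.m<n⇒0<n∸m d<N
    -- On a sequence starting like `δ i`, the form `R` returns its coefficient `R i`: the other
    -- terms below `f` meet a zero of `s`, and the rest a zero of `R`.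
    R⋆s : ∀ i → i Fin.< f → ∀ s → (∀ e → e ℕ.< toℕ f → s e ≈ δ (toℕ i) e) → (R ⋆ s) 0 ≈ R i
    R⋆s i i<f s s≈δ = trans
      (sum-single (λ e → R e · s (toℕ e ℕ.+ 0)) i off)
      (trans (*-congˡ (trans (s+0 i) (trans (s≈δ (toℕ i) i<f) (δ-diagonal (toℕ i)))))
             (*-identityʳ (R i)))
      where
      s+0 : ∀ (e : Fin (suc d)) → s (toℕ e ℕ.+ 0) ≈ s (toℕ e)
      s+0 e = reflexive (≡.cong s (ℕ.+-identityʳ (toℕ e)))
      off : ∀ e → e ≢ i → R e · s (toℕ e ℕ.+ 0) ≈ 0#
      off e e≢i with ℕ.≤-<-connex (toℕ f) (toℕ e)
      ... | inj₁ f≤e = trans (*-congʳ (R≈0-beyond e f≤e)) (zeroˡ _)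
      ... | inj₂ e<f = trans
        (*-congˡ (trans (s+0 e)
          (trans (s≈δ (toℕ e) e<f) (δ-off λ eq → e≢i (Fin.toℕ-injective (≡.sym eq))))))
        (zeroʳ (R e))
    R≈0 : ∀ i → R i ≈ 0#
    R≈0 i with ℕ.≤-<-connex (toℕ f) (toℕ i)
    ... | inj₁ f≤i = R≈0-beyond i f≤i
    ... | inj₂ i<f
      with s , s≈δ , Qs≈0 ← recurrent Q f lead (δ (toℕ i)) (N ∸ d) = begin
        R i                              ≈⟨ R⋆s i i<f s s≈δ ⟨
        (R ⋆ s) 0                        ≈⟨ ⋆-linearˡ P Q (- a) s 0 ⟩
        (P ⋆ s) 0 + - a · (Q ⋆ s) 0      ≈⟨ x+y*0≈x (- a) (Qs≈0 0 0<N∸d) ⟩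
        (P ⋆ s) 0                        ≈⟨ annihilates s Qs≈0 0 0<N∸d ⟩
        0#                               ∎
    P≈aQ : ∀ i → P i ≈ a · Q i
    P≈aQ i = x+-y*z≈0⇒x≈y*z (R≈0 i)

  -- Settles degree 0, also for `N ≡ 0`, where every kernel is the whole zero space and cannot
  -- separate forms: `V 1` is a line.
  constants : {P Q : V 1} → ¬ P ≋ 0ᵛ → ¬ Q ≋ 0ᵛ → P ∝ Q
  constants {P} {Q} P≢0 Q≢0 with Fin.zero , Q₀≉0 ← nonzero-entry Q Q≢0
    with b , bQ₀≈1 ← inverse Q₀≉0 = multiple⇒∝ (P Fin.zero · b) P≢0 λ where
      Fin.zero → sym (trans (*-assoc _ _ _) (trans (*-congˡ bQ₀≈1) (*-identityʳ _)))

  -- Counting the points of a projective space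

  record ProjectivePoints {p D} (S : Pred (Vector Carrier D) p) (n : ℕ) : Set (c ⊔ ℓ ⊔ p) where
    field
      -- One representative for each line of vectors in `S`, so `n` is the number of points of its
      -- projective space, and no quotient has to be formed.
      point           : Fin n → Vector Carrier D
      point∈          : ∀ i → S (point i)
      point≢0         : ∀ i → ¬ point i ≋ 0ᵛ
      point-injective : ∀ {i j} → point i ∝ point j → i ≡ j
      index           : ∀ {Q} → S Q → ¬ Q ≋ 0ᵛ → ∃[ i ] Q ∝ point i

  open ProjectivePoints

  -- Sending each representative in the first system to the one on the same line in the second is
  -- injective, because `∝` is symmetric and transitive.
  points-≤ : ∀ {p D m n} {S : Pred (Vector Carrier D) p} →
             ProjectivePoints S m → ProjectivePoints S n → m ≤ n
  points-≤ p r = Fin.injective⇒≤ {f = φ} λ {i} {j} φi≡φj → point-injective p (∝-trans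
    (proj₂ (index r (point∈ p i) (point≢0 p i)))
    (≡.subst (λ e → point r e ∝ point p j) (≡.sym φi≡φj)
      (∝-sym {P = point p j} (proj₂ (index r (point∈ p j) (point≢0 p j))))))
    where
    φ : Fin _ → Fin _
    φ i = proj₁ (index r (point∈ p i) (point≢0 p i))

  points-unique : ∀ {p D m n} {S : Pred (Vector Carrier D) p} →
                  ProjectivePoints S m → ProjectivePoints S n → m ≡ n
  points-unique p r = ℕ.≤-antisym (points-≤ p r) (points-≤ r p)

  element : Fin q → Carrier
  element = Inverse.from enumeration

  element-injective : ∀ {i j} → element i ≈ element j → i ≡ j
  element-injective {i} {j} eq = ≡.trans (≡.sym (Inverse.strictlyInverseˡ enumeration i))
    (≡.trans (Inverse.to-cong enumeration eq) (Inverse.strictlyInverseˡ enumeration j))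

  -- The points of a space from those of a hyperplane

  module _ {p D n} {S : Pred (Vector Carrier D) p}
           (linear : ∀ {P Q} a → S P → S Q → S (P +[ a ] Q))
           {F : Vector Carrier D} (F∈ : S F) {f : Fin D} (Ff≉0 : F f ≉ 0#)
           (hyperplane : ProjectivePoints (λ Q → S Q × Q f ≈ 0#) n) where

    private
      module U = ProjectivePoints hyperplane

      -- The entries at `f` determine the multiples of `F`, since `P` and `P′` vanish there and
      -- `F f` is invertible; cancelling these multiples leaves `P` and `P′`.
      coordinates : ∀ {P P′ : Vector Carrier D} {a a′ b} → P f ≈ 0# → P′ f ≈ 0# →
                    (∀ i → P i + a · F i ≈ b · (P′ i + a′ · F i)) →
                    a ≈ b · a′ × (∀ i → P i ≈ b · P′ i)
      coordinates {P} {P′} {a} {a′} {b} Pf≈0 P′f≈0 eq = a≈ba′ , λ i →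
        ∙-cancelʳ (a · F i) (P i) (b · P′ i) (trans (eq i) (trans (distribˡ b _ _)
          (+-congˡ (trans (sym (*-assoc b a′ (F i))) (*-congʳ (sym a≈ba′))))))
        where
        a≈ba′ : a ≈ b · a′
        a≈ba′ with e , eFf≈1 ← inverse Ff≉0 = begin
          a                              ≈⟨ cancel eFf≈1 ⟨
          e · (F f · a)                  ≈⟨ *-congˡ (*-comm (F f) a) ⟩
          e · (a · F f)                  ≈⟨ *-congˡ (trans (+-congʳ Pf≈0) (+-identityˡ _)) ⟨
          e · (P f + a · F f)            ≈⟨ *-congˡ (eq f) ⟩
          e · (b · (P′ f + a′ · F f))    ≈⟨ *-congˡ (*-congˡ (trans (+-congʳ P′f≈0) (+-identityˡ _))) ⟩
          e · (b · (a′ · F f))           ≈⟨ *-congˡ (trans (sym (*-assoc b a′ (F f))) (*-comm _ _)) ⟩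
          e · (F f · (b · a′))           ≈⟨ cancel eFf≈1 ⟩
          b · a′                         ∎

      translate : Fin q × Fin n → Vector Carrier D
      translate (e , i) = U.point i +[ element e ] F

      -- Projection from the point of `F`: each line joining it to a point of the hyperplane carries
      -- `q` further points, `U.point i + a F` with `a` in the field.
      point′ : Fin (suc (q * n)) → Vector Carrier D
      point′ Fin.zero    = F
      point′ (Fin.suc t) = translate (Fin.remQuot {q} n t)

      F∝̸translate : ∀ t → ¬ F ∝ translate t
      F∝̸translate (e , i) (b , b≉0 , F≈) = U.point≢0 i λ l →
        integral b≉0 (sym (proj₂ (coordinates {0ᵛ} {U.point i} {1#} {element e} refl (proj₂ (U.point∈ i))
          λ l → trans (trans (+-identityˡ _) (*-identityˡ _)) (F≈ l)) l))

      translate-injective : ∀ s t → translate s ∝ translate t → s ≡ t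
      translate-injective (e , i) (e′ , i′) (b , b≉0 , eq)
        with e≈be′ , P≈bP′ ← coordinates {U.point i} {U.point i′} {element e} {element e′}
               (proj₂ (U.point∈ i)) (proj₂ (U.point∈ i′)) eq
        -- Proportional hyperplane parts are the same representative; a nonzero entry of it then
        -- forces the ratio `b` to be 1, and `e≈be′` identifies the scalars.
        with ≡.refl ← U.point-injective {i} {i′} (b , b≉0 , P≈bP′)
        with l , Pl≉0 ← nonzero-entry (U.point i) (U.point≢0 i)
        with g , gPl≈1 ← inverse Pl≉0 = ≡.cong (_, i)
          (element-injective (trans e≈be′ (trans (*-congʳ b≈1) (*-identityˡ _))))
        where
        P = U.point i
        b≈1 : b ≈ 1#
        b≈1 = begin
          b              ≈⟨ cancel gPl≈1 ⟨
          g · (P l · b)  ≈⟨ *-congˡ (trans (P≈bP′ l) (*-comm b (P l))) ⟨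
          g · P l        ≈⟨ gPl≈1 ⟩
          1#             ∎

      translate∈ : ∀ t → S (translate t)
      translate∈ (e , i) = linear (element e) (proj₁ (U.point∈ i)) F∈

      translate≢0 : ∀ t → ¬ translate t ≋ 0ᵛ
      translate≢0 (e , i) eq = U.point≢0 i λ l → trans
        (proj₂ (coordinates {U.point i} {0ᵛ} {element e} {0#} {0#} (proj₂ (U.point∈ i)) refl
          λ l → trans (eq l) (sym (zeroˡ _))) l)
        (zeroʳ 0#)

      index′ : ∀ {Q} → S Q → ¬ Q ≋ 0ᵛ → ∃[ t ] Q ∝ point′ t
      index′ {Q} Q∈ Q≢0 with b , bFf≈1 ← inverse Ff≉0 = go (P ≋? 0ᵛ)
        where
        a = Q f · b
        P = Q +[ - a ] F
        P∈ : S P × P f ≈ 0#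
        P∈ = linear (- a) Q∈ F∈ ,
          x+-y*z≈0 (sym (trans (*-assoc (Q f) b (F f)) (trans (*-congˡ bFf≈1) (*-identityʳ (Q f)))))
        Q≈P+aF : ∀ i → Q i ≈ P i + a · F i
        Q≈P+aF i = sym (trans (+-assoc _ _ _) (trans
          (+-congˡ (trans (+-congʳ (sym (-‿distribˡ-* a (F i)))) (-‿inverseˡ _))) (+-identityʳ _)))
        go : Dec (P ≋ 0ᵛ) → ∃[ t ] Q ∝ point′ t
        go (yes P≋0) = Fin.zero , multiple⇒∝ a Q≢0 λ i → x+-y*z≈0⇒x≈y*z (P≋0 i)
        go (no P≢0) with i , g , g≉0 , P≈gP′ ← U.index P∈ P≢0
          with h , hg≈1 ← inverse g≉0 =
          Fin.suc (Fin.combine e i) ,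
          ≡.subst (λ t → Q ∝ translate t) (≡.sym (Fin.remQuot-combine e i)) (g , g≉0 , λ l → begin
            Q l                                          ≈⟨ Q≈P+aF l ⟩
            P l + a · F l                                ≈⟨ +-cong (P≈gP′ l) (*-congʳ a≈ge) ⟩
            g · U.point i l + g · element e · F l        ≈⟨ +-congˡ (*-assoc g (element e) (F l)) ⟩
            g · U.point i l + g · (element e · F l)      ≈⟨ distribˡ g _ _ ⟨
            g · translate (e , i) l                      ∎)
          where
          -- As `P = g P′` for a representative `P′`, the form `Q` is `g (P′ + (a / g) F)`, and
          -- `h · a` is this quotient.
          e = Inverse.to enumeration (h · a)
          a≈ge : a ≈ g · element e
          a≈ge = sym (trans (*-congˡ (Inverse.strictlyInverseʳ enumeration (h · a)))
            (trans (sym (*-assoc g h a)) (trans (*-congʳ (trans (*-comm g h) hg≈1)) (*-identityˡ a))))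

      injective′ : ∀ s t → point′ s ∝ point′ t → s ≡ t
      injective′ Fin.zero    Fin.zero    _  = ≡.refl
      injective′ Fin.zero    (Fin.suc t) eq = contradiction eq (F∝̸translate _)
      injective′ (Fin.suc s) Fin.zero    eq = contradiction (∝-sym {Q = F} eq) (F∝̸translate _)
      injective′ (Fin.suc s) (Fin.suc t) eq = ≡.cong Fin.suc (≡.trans
        (≡.sym (Fin.combine-remQuot {q} n s)) (≡.trans
          (≡.cong (uncurry Fin.combine) (translate-injective _ _ eq)) (Fin.combine-remQuot {q} n t)))

    points-hyperplane : ProjectivePoints S (suc (q * n))
    points-hyperplane = record
      { point           = point′
      ; point∈          = λ where Fin.zero → F∈ ; (Fin.suc t) → translate∈ _
      ; point≢0         = λ where Fin.zero F≋0 → Ff≉0 (F≋0 f) ; (Fin.suc t) → translate≢0 _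
      ; point-injective = λ {s} {t} → injective′ s t
      ; index           = index′
      }

  -- Multiplication of forms by Z (`raise`) and by Y (`0# Vector.∷_`)

  raise : ∀ {d} → V (suc d) → V (suc (suc d))
  raise Q = extend Q ∘ toℕ

  raise-inject₁ : ∀ {d} (Q : V (suc d)) i → raise Q (Fin.inject₁ i) ≈ Q i
  raise-inject₁ Q i rewrite Fin.toℕ-inject₁ i = extend-toℕ Q i

  raise-fromℕ : ∀ {d} (Q : V (suc d)) → raise Q (Fin.fromℕ (suc d)) ≈ 0#
  raise-fromℕ {d} Q = extend-beyond Q (ℕ.s≤s (ℕ.≤-reflexive (≡.sym (Fin.toℕ-fromℕ d))))

  ⋆-init : ∀ {d} (Q : V (suc (suc d))) y j → Q (Fin.fromℕ (suc d)) ≈ 0# →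
           (Q ⋆ y) j ≈ ((Q ∘ Fin.inject₁) ⋆ y) j
  ⋆-init {d} Q y j last≈0 = trans (sum-init-last (λ i → Q i · y (toℕ i ℕ.+ j)))
    (trans (+-congˡ (trans (*-congʳ last≈0) (zeroˡ _))) (trans (+-identityʳ _)
      (sum-cong {suc d} λ i → *-congˡ {Q (Fin.inject₁ i)}
        (reflexive (≡.cong (λ a → y (a ℕ.+ j)) (Fin.toℕ-inject₁ i))))))

  ⋆-raise : ∀ {d} (Q : V (suc d)) y j → (raise Q ⋆ y) j ≈ (Q ⋆ y) j
  ⋆-raise {d} Q y j = trans (⋆-init (raise Q) y j (raise-fromℕ Q))
    (sum-cong {suc d} λ i → *-congʳ {y (toℕ i ℕ.+ j)} (raise-inject₁ Q i))

  ⋆-shift : ∀ {d} (Q : V (suc d)) y j → ((0# Vector.∷ Q) ⋆ y) j ≈ (Q ⋆ y) (suc j)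
  ⋆-shift {d} Q y j = trans (+-congʳ (zeroˡ (y j))) (trans (+-identityˡ _)
    (sum-cong {suc d} λ i → *-congˡ {Q i} (reflexive (≡.cong y (≡.sym (ℕ.+-suc (toℕ i) j))))))

  -- The forms annihilating a fixed sequence

  module _ {N} (x : W N) where

    Annihilator : ∀ d → Pred (V (suc d)) ℓ
    Annihilator d Q = ker N Q x

    private
      y : ℕ → Carrier
      y = extend x

    annihilates⇒⋆≈0 : ∀ {d} {Q : V (suc d)} → Annihilator d Q → ∀ j → j ℕ.< N ∸ d → (Q ⋆ y) j ≈ 0#
    annihilates⇒⋆≈0 {Q = Q} Q∈ = ker⇒⋆≈0 {N} {Q = Q} (ker-resp Q (λ i → sym (extend-toℕ x i)) Q∈)

    ⋆≈0⇒annihilates : ∀ {d} {Q : V (suc d)} → (∀ j → j ℕ.< N ∸ d → (Q ⋆ y) j ≈ 0#) → Annihilator d Q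
    ⋆≈0⇒annihilates {Q = Q} Qy≈0 = ker-resp Q (extend-toℕ x) (⋆≈0⇒ker {N} {Q = Q} Qy≈0)

    annihilator-linear : ∀ {d} {P Q : V (suc d)} a →
                         Annihilator d P → Annihilator d Q → Annihilator d (P +[ a ] Q)
    annihilator-linear {P = P} {Q} a P∈ Q∈ = ⋆≈0⇒annihilates {Q = P +[ a ] Q} λ j j< →
      trans (⋆-linearˡ P Q a y j) (trans (x+y*0≈x a (annihilates⇒⋆≈0 {Q = Q} Q∈ j j<))
        (annihilates⇒⋆≈0 {Q = P} P∈ j j<))

    -- The conditions on `Z Q` are those on `Q` with the last one, if any, dropped; for `Y Q`, in
    -- `shift-annihilates`, the first one is dropped.
    raise-annihilates : ∀ {d} {Q : V (suc d)} → Annihilator d Q → Annihilator (suc d) (raise Q)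
    raise-annihilates {d} {Q} Q∈ = ⋆≈0⇒annihilates {Q = raise Q} λ j j< → trans (⋆-raise Q y j)
      (annihilates⇒⋆≈0 {Q = Q} Q∈ j (ℕ.<-≤-trans j< (ℕ.∸-monoʳ-≤ N (ℕ.n≤1+n d))))

    shift-annihilates : ∀ {d} {Q : V (suc d)} → suc d ≤ N →
                        Annihilator d Q → Annihilator (suc d) (0# Vector.∷ Q)
    shift-annihilates {d} {Q} d<N Q∈ = ⋆≈0⇒annihilates {Q = 0# Vector.∷ Q} λ j j< →
      trans (⋆-shift Q y j)
        (annihilates⇒⋆≈0 {Q = Q} Q∈ (suc j) (≡.subst (suc j ℕ.<_) (≡.sym (ℕ.+-∸-assoc 1 d<N)) (ℕ.s<s j<)))

    Supported : ∀ d → Fin (suc d) → Set (c ⊔ ℓ)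
    Supported d f = ∀ {Q} → Annihilator d Q → ∀ i → f Fin.< i → Q i ≈ 0#

    entry? : ∀ {d} → Decidable (λ i → ∃[ F ] Annihilator d F × F i ≉ 0#)
    entry? i = ∃?
      (λ {P} {R} P≋R (P∈ , Pi≉0) →
        ker-⊆-cong {Q = P} {R} P≋R {x} P∈ , λ Ri≈0 → Pi≉0 (trans (P≋R i) Ri≈0))
      (λ F → ker? {N} F x ×-dec ¬? (F i ≟ 0#))

    -- The exponent `f` is maximal over the whole space rather than for one form: it is the leading
    -- exponent of `F`, and a form of the space without `Y^f` has all its exponents below `f`. The
    -- finite search `entry?` makes the maximum available.
    pivot : ∀ {d Q} → Annihilator d Q → ¬ Q ≋ 0ᵛ →
            ∃[ f ] (∃[ F ] Annihilator d F × F f ≉ 0#) × Supported d f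
    pivot {d} {Q} Q∈ Q≢0 with i , Qi≉0 ← nonzero-entry Q Q≢0
      with f , ∃F , f-max ← maximal entry? (i , Q , Q∈ , Qi≉0) =
      f , ∃F , λ {Q} Q∈ i f<i → decidable-stable (Q i ≟ 0#) λ Qi≉0 → f-max i f<i (Q , Q∈ , Qi≉0)

    -- With e = N - d - 1, the term F_f (Q ⋆ y)_e is the only one of F ⋆ (Q ⋆ y) at
    -- e - f that need not vanish, while Q ⋆ (F ⋆ y) vanishes there as Q has degree
    -- less than f in Y.
    lower : ∀ {d F f Q} → toℕ f ≤ N ∸ suc d → suc d ≤ N →
            Annihilator (suc d) F → Leading F f →
            Annihilator (suc d) Q → (∀ i → toℕ f ≤ toℕ i → Q i ≈ 0#) →
            Annihilator d (Q ∘ Fin.inject₁)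
    lower {d} {F} {f} {Q} f≤e d<N F∈ (Ff≉0 , F≈0) Q∈ Q≈0 =
      ⋆≈0⇒annihilates {Q = Q ∘ Fin.inject₁} λ j j< →
        trans (sym (⋆-init Q y j (Q≈0 (Fin.fromℕ (suc d)) (Fin.≤fromℕ f))))
          (Qy≈0 j (≡.subst (j ℕ.<_) (ℕ.+-∸-assoc 1 d<N) j<))
      where
      e = N ∸ suc d
      f+[e∸f]≡e : toℕ f ℕ.+ (e ∸ toℕ f) ≡ e
      f+[e∸f]≡e = ℕ.m+[n∸m]≡n f≤e
      below : ∀ (i : Fin (suc (suc d))) → i Fin.< f → toℕ i ℕ.+ (e ∸ toℕ f) ℕ.< e
      below i i<f = ≡.subst (toℕ i ℕ.+ (e ∸ toℕ f) ℕ.<_) f+[e∸f]≡e (ℕ.+-monoˡ-< (e ∸ toℕ f) i<f)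
      Q⋆F⋆y : ∀ i → Q i · (F ⋆ y) (toℕ i ℕ.+ (e ∸ toℕ f)) ≈ 0#
      Q⋆F⋆y i with ℕ.≤-<-connex (toℕ f) (toℕ i)
      ... | inj₁ f≤i = trans (*-congʳ (Q≈0 i f≤i)) (zeroˡ _)
      ... | inj₂ i<f = trans (*-congˡ (annihilates⇒⋆≈0 {Q = F} F∈ _ (below i i<f))) (zeroʳ (Q i))
      F⋆Q⋆y : ∀ i → i ≢ f → F i · (Q ⋆ y) (toℕ i ℕ.+ (e ∸ toℕ f)) ≈ 0#
      F⋆Q⋆y i i≢f with ℕ.<-cmp (toℕ f) (toℕ i)
      ... | tri< f<i _ _ = trans (*-congʳ (F≈0 i f<i)) (zeroˡ _)
      ... | tri≈ _ f≡i _ = contradiction (Fin.toℕ-injective (≡.sym f≡i)) i≢f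
      ... | tri> _ _ i<f = trans (*-congˡ (annihilates⇒⋆≈0 {Q = Q} Q∈ _ (below i i<f))) (zeroʳ (F i))
      FfQy≈0 : F f · (Q ⋆ y) e ≈ 0#
      FfQy≈0 = begin
        F f · (Q ⋆ y) e                              ≡⟨ ≡.cong (λ j → F f · (Q ⋆ y) j) f+[e∸f]≡e ⟨
        F f · (Q ⋆ y) (toℕ f ℕ.+ (e ∸ toℕ f))        ≈⟨ sum-single (λ i → F i · (Q ⋆ y) (toℕ i ℕ.+ (e ∸ toℕ f))) f F⋆Q⋆y ⟨
        (F ⋆ (Q ⋆ y)) (e ∸ toℕ f)                    ≈⟨ ⋆-comm F Q y (e ∸ toℕ f) ⟩
        (Q ⋆ (F ⋆ y)) (e ∸ toℕ f)                    ≈⟨ sum-zero Q⋆F⋆y ⟩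
        0#                                           ∎
      -- Lowering the degree adds the single condition at `e`.
      Qy≈0 : ∀ j → j ℕ.< suc e → (Q ⋆ y) j ≈ 0#
      Qy≈0 j j<1+e with ℕ.m<1+n⇒m<n∨m≡n j<1+e
      ... | inj₁ j<e    = annihilates⇒⋆≈0 {Q = Q} Q∈ j j<e
      ... | inj₂ ≡.refl = integral Ff≉0 FfQy≈0

    -- If `f` is not the top exponent, the coefficient of `Z Q` at `f` is that of `Y Q` at `f + 1`;
    -- as `Y Q` annihilates `x` too, it is zero by maximality of `f`.
    raise-vanishes : ∀ {d f} → suc d ≤ N → Supported (suc d) f →
                     ∀ {Q} → Annihilator d Q → raise Q f ≈ 0#
    raise-vanishes {f = f} d<N supp {Q} Q∈ with view f
    ... | ‵fromℕ     = raise-fromℕ Q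
    ... | ‵inject₁ i = trans (raise-inject₁ Q i)
      (supp {0# Vector.∷ Q} (shift-annihilates {Q = Q} d<N Q∈) (Fin.suc i)
        (ℕ.s≤s (ℕ.≤-reflexive (Fin.toℕ-inject₁ i))))

    -- Multiplication by Z is an isomorphism from the annihilator in degree `d` onto the forms
    -- without `Y^f` in degree `d + 1`: `raise-vanishes` shows that it lands there, `lower` that it
    -- is onto. Hence representatives go to representatives.
    raise-points : ∀ {d n F f} → toℕ f ≤ N ∸ suc d → suc d ≤ N →
                   Annihilator (suc d) F → F f ≉ 0# → Supported (suc d) f →
                   ProjectivePoints (Annihilator d) n →
                   ProjectivePoints (λ Q → Annihilator (suc d) Q × Q f ≈ 0#) n
    raise-points {d} {n} {F} {f} f≤e d<N F∈ Ff≉0 supp p = record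
      { point           = raise ∘ point p
      ; point∈          = λ i → raise-annihilates {Q = point p i} (point∈ p i) ,
                                raise-vanishes d<N supp {point p i} (point∈ p i)
      ; point≢0         = λ i raise≋0 → point≢0 p i λ l →
                            trans (sym (raise-inject₁ (point p i) l)) (raise≋0 (Fin.inject₁ l))
      ; point-injective = λ {i} {j} (a , a≉0 , eq) → point-injective p (a , a≉0 , λ l →
                            trans (sym (raise-inject₁ (point p i) l))
                              (trans (eq (Fin.inject₁ l)) (*-congˡ (raise-inject₁ (point p j) l))))
      ; index           = index′
      }
      where
      vanishes : ∀ {Q} → Annihilator (suc d) Q → Q f ≈ 0# → ∀ i → toℕ f ≤ toℕ i → Q i ≈ 0#
      vanishes {Q} Q∈ Qf≈0 i f≤i with ℕ.m≤n⇒m<n∨m≡n f≤i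
      ... | inj₁ f<i = supp {Q} Q∈ i f<i
      ... | inj₂ f≡i with ≡.refl ← Fin.toℕ-injective {i = f} {i} f≡i = Qf≈0
      by-view : ∀ {P R : V (suc (suc d))} → P (Fin.fromℕ (suc d)) ≈ R (Fin.fromℕ (suc d)) →
                (∀ i → P (Fin.inject₁ i) ≈ R (Fin.inject₁ i)) → ∀ i → P i ≈ R i
      by-view last init i with view i
      ... | ‵fromℕ     = last
      ... | ‵inject₁ j = init j
      index′ : ∀ {Q} → Annihilator (suc d) Q × Q f ≈ 0# → ¬ Q ≋ 0ᵛ → ∃[ i ] Q ∝ raise (point p i)
      index′ {Q} (Q∈ , Qf≈0) Q≢0
        with last≈0 ← vanishes {Q} Q∈ Qf≈0 (Fin.fromℕ (suc d)) (Fin.≤fromℕ f)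
        with i , a , a≉0 , eq ← index p {Q ∘ Fin.inject₁}
          (lower {F = F} {f} {Q} f≤e d<N F∈ (Ff≉0 , supp {F} F∈) Q∈ (vanishes {Q} Q∈ Qf≈0))
          (λ init≋0 → Q≢0 (by-view {Q} {0ᵛ} last≈0 init≋0)) =
        i , a , a≉0 , by-view {Q} {λ l → a · raise (point p i) l}
          (trans last≈0 (sym (trans (*-congˡ (raise-fromℕ (point p i))) (zeroʳ a))))
          (λ l → trans (eq l) (*-congˡ (sym (raise-inject₁ (point p i) l))))

    -- The sum over `𝐏 N d` as a number of points

    χ-sum : ∀ {d} (Ks : List (𝐏.Carrier {N} {d})) →
            foldr ℤ._+_ 0ℤ (map (λ K → χ (∈? {N} {d} K) x) Ks) ≡
            + length (filter (λ K → ∈? {N} {d} K x) Ks)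
    χ-sum []       = ≡.refl
    χ-sum (K ∷ Ks) with does (∈? K x)
    ... | true  = ≡.cong (λ n → 1ℤ ℤ.+ n) (χ-sum Ks)
    ... | false = ≡.trans (ℤ.+-identityˡ _) (χ-sum Ks)

    -- The witness forms of the kernels containing `x` represent the lines of the annihilator: each
    -- annihilating form is proportional to the witness with the same kernel, and as proportional
    -- forms have equal kernels, a list free of repetitions meets no line twice.
    members-points : ∀ d → d ℕ.< N ⊎ d ≡ 0 →
                     ∃[ n ] ProjectivePoints (Annihilator d) n × ∑χ d x ≡ + n
    members-points d d<N∨d≡0 = length Ks , points , χ-sum (members N d)
      where
      open Setoid (𝐏.setoid {N} {d}) using () renaming (_≈_ to _≈ᴷ_)
      P? : Decidable (λ (K : 𝐏.Carrier {N} {d}) → proj₁ K x)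
      P? K = ∈? K x
      resp : (λ K → proj₁ K x) B.Respects _≈ᴷ_
      resp (K⊆ , _) = K⊆
      Ks = filter P? (members N d)
      form : Fin (length Ks) → V (suc d)
      form i = proj₁ (proj₂ (lookup Ks i))
      form≢0 : ∀ i → ¬ form i ≋ 0ᵛ
      form≢0 i = proj₁ (proj₂ (proj₂ (lookup Ks i)))
      lookup≐ker : ∀ i → proj₁ (lookup Ks i) ≐ ker N (form i)
      lookup≐ker i = proj₂ (proj₂ (proj₂ (lookup Ks i)))
      x∈lookup : ∀ i → proj₁ (lookup Ks i) x
      x∈lookup i = proj₂ (∈-filter⁻ (𝐏.setoid {N} {d}) P? (λ {K} {K′} → resp {K} {K′})
        {v = lookup Ks i} {xs = members N d}
        (∈-lookup (𝐏.setoid {N} {d}) Ks i))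
      same-ker⇒∝ : ∀ {P Q : V (suc d)} → ¬ P ≋ 0ᵛ → ¬ Q ≋ 0ᵛ → ker N P ≐ ker N Q → P ∝ Q
      same-ker⇒∝ {P} {Q} P≢0 Q≢0 (_ , ker⊆) = case d<N∨d≡0 of λ where
        (inj₁ d<N)    → ker⊆ker⇒∝ d<N P≢0 Q≢0 λ {x} → ker⊆ {x}
        (inj₂ ≡.refl) → constants P≢0 Q≢0
      index′ : ∀ {Q} → Annihilator d Q → ¬ Q ≋ 0ᵛ → ∃[ i ] Q ∝ form i
      index′ {Q} Q∈ Q≢0 = i , same-ker⇒∝ Q≢0 (form≢0 i) (≐-trans (lookup-index K∈) (lookup≐ker i))
        where
        K∈ = ∈-filter⁺ (𝐏.setoid {N} {d}) P? (λ {K} {K′} → resp {K} {K′})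
          {v = ker N Q , Q , Q≢0 , ≐-refl}
          (members-enumerate N d (ker N Q , Q , Q≢0 , ≐-refl)) Q∈
        i = Any.index K∈
      points : ProjectivePoints (Annihilator d) (length Ks)
      points = record
        { point           = form
        ; point∈          = λ i → proj₁ (lookup≐ker i) (x∈lookup i)
        ; point≢0         = form≢0
        ; point-injective = λ {i} {j} eq → unique-lookup (𝐏.setoid {N} {d})
                              (Unique.filter⁺ (𝐏.setoid {N} {d}) P? (members-unique N d)) i j
                              (≐-trans (lookup≐ker i) (≐-trans (∝⇒ker≐ker eq) (≐-sym (lookup≐ker j))))
        ; index           = index′
        }

    -- From degree `m - 1` to degree `m`

    no-points : ∀ {d n} → (∀ {Q} → Annihilator d Q → Q ≋ 0ᵛ) → ProjectivePoints (Annihilator d) n → n ≡ 0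
    no-points {n = zero}  _        _ = ≡.refl
    no-points {n = suc n} trivial p =
      contradiction (trivial {point p Fin.zero} (point∈ p Fin.zero)) (point≢0 p Fin.zero)

    -- The case `m = 0`: the constants with vanishing coefficient are zero, in accordance with the
    -- empty sum in `∑χ-pred`.
    points-zero : ∀ f → ProjectivePoints (λ Q → Annihilator 0 Q × Q f ≈ 0#) 0
    points-zero f = record
      { point           = λ ()
      ; point∈          = λ ()
      ; point≢0         = λ ()
      ; point-injective = λ { {()} }
      ; index           = λ {Q} (_ , Qf≈0) Q≢0 → contradiction (all-zero Q f Qf≈0) Q≢0
      }
      where
      all-zero : ∀ (Q : V 1) f → Q f ≈ 0# → Q ≋ 0ᵛ
      all-zero Q Fin.zero Q₀≈0 Fin.zero = Q₀≈0

    -- The exponent `f` is produced by `pivot` inside the proof, so the hyperplane is supplied for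
    -- all admissible `f`, with one count `n′` for all of them. The two counts in degree `m` then
    -- agree by `points-unique`.
    points-step : ∀ {m n n′ Q} → Annihilator m Q → ¬ Q ≋ 0ᵛ → ProjectivePoints (Annihilator m) n →
                  (∀ {F f} → Annihilator m F → F f ≉ 0# → Supported m f →
                    ProjectivePoints (λ Q → Annihilator m Q × Q f ≈ 0#) n′) →
                  n ≡ suc (q * n′)
    points-step {m} {Q = Q} Q∈ Q≢0 p hyperplane
      with f , (F , F∈ , Ff≉0) , supp ← pivot {m} {Q} Q∈ Q≢0 =
      points-unique p (points-hyperplane (λ {P} {Q} → annihilator-linear {P = P} {Q}) {F} F∈ {f} Ff≉0
        (hyperplane {F} {f} F∈ Ff≉0 (λ {Q} → supp {Q})))

    -- Collects what is used from degree `m - 1`, so that `m = 0`, where there are no forms of that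
    -- degree, and `m > 0` are treated alike.
    record Predecessor (m : ℕ) : Set (c ⊔ ℓ) where
      field
        count      : ℕ
        ∑χ-pred≡   : ∑χ-pred m x ≡ + count
        hyperplane : ∀ {F f} → Annihilator m F → F f ≉ 0# → Supported m f →
                     ProjectivePoints (λ Q → Annihilator m Q × Q f ≈ 0#) count
        trivial    : (∀ {Q} → Annihilator m Q → Q ≋ 0ᵛ) → count ≡ 0

    predecessor : ∀ m → 2 * m ≤ N → Predecessor m
    predecessor zero    _    = record
      { count      = 0
      ; ∑χ-pred≡   = ≡.refl
      ; hyperplane = λ {_} {f} _ _ _ → points-zero f
      ; trivial    = λ _ → ≡.refl
      }
    predecessor (suc d) 2m≤N = record
      { count      = proj₁ counted
      ; ∑χ-pred≡   = proj₂ (proj₂ counted)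
      ; hyperplane = λ {F} {f} F∈ Ff≉0 supp → raise-points {F = F}
                       (ℕ.≤-trans (ℕ.s≤s⁻¹ (Fin.toℕ<n f)) m≤N∸m) d<N F∈ Ff≉0 (λ {Q} → supp {Q})
                       (proj₁ (proj₂ counted))
      -- Multiplication by Z embeds the annihilator in degree `d` into the one in degree `d + 1`, so
      -- the former vanishes with the latter.
      ; trivial    = λ all≋0 → no-points
                       (λ {Q} Q∈ l → trans (sym (raise-inject₁ Q l))
                         (all≋0 {raise Q} (raise-annihilates {Q = Q} Q∈) (Fin.inject₁ l)))
                       (proj₁ (proj₂ counted))
      }
      where
      d<N : d ℕ.< N
      d<N = ℕ.≤-trans (ℕ.m≤m+n (suc d) _) 2m≤N
      -- The bound `2 m ≤ n + 1` enters in full here: with `f ≤ m` it gives the inequality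
      -- `f ≤ N ∸ m` for `lower`.
      m≤N∸m : suc d ≤ N ∸ suc d
      m≤N∸m = ℕ.m+n≤o⇒m≤o∸n (suc d)
        (≡.subst (λ e → suc d ℕ.+ e ≤ N) (ℕ.+-identityʳ (suc d)) 2m≤N)
      counted : ∃[ n ] ProjectivePoints (Annihilator d) n × ∑χ d x ≡ + n
      counted = members-points d (inj₁ d<N)

    ∉H⇒trivial : ∀ {m} → ¬ H m x → ∀ {Q} → Annihilator m Q → Q ≋ 0ᵛ
    ∉H⇒trivial x∉H {Q} Q∈ = decidable-stable (Q ≋? 0ᵛ) λ Q≢0 → x∉H (Q , Q≢0 , Q∈)

    m<N∨m≡0 : ∀ {m} → 2 * m ≤ N → m ℕ.< N ⊎ m ≡ 0
    m<N∨m≡0 {zero}  _    = inj₂ ≡.refl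
    m<N∨m≡0 {suc d} 2m≤N = inj₁ (ℕ.<-≤-trans (ℕ.m<m+n (suc d) ℕ.z<s) 2m≤N)

    χH≡∑χ-∑χ : ∀ m → 2 * m ≤ N → χ (H? {N} m) x ≡ ∑χ m x - (+ q) *ℤ ∑χ-pred m x
    χH≡∑χ-∑χ m 2m≤N = indicator≡difference (H? {N} m x) {q = q} (proj₂ (proj₂ counted)) P.∑χ-pred≡
      -- A proof of `H m x` unfolds to a nonzero form in `Annihilator m`.
      (λ (Q , Q≢0 , Q∈) → points-step {Q = Q} Q∈ Q≢0 (proj₁ (proj₂ counted))
        λ {F} → P.hyperplane {F})
      (λ x∉H → no-points {m} (∉H⇒trivial x∉H) (proj₁ (proj₂ counted)) , P.trivial (∉H⇒trivial x∉H))
      where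
      module P = Predecessor (predecessor m 2m≤N)
      counted : ∃[ n ] ProjectivePoints (Annihilator m) n × ∑χ m x ≡ + n
      counted = members-points m (m<N∨m≡0 2m≤N)

proposition2 : ∀ {c ℓ} {q : ℕ} (k : FiniteField c ℓ q) → let open Sequences k in
    (m n+1 : ℕ) → 2 * m ≤ n+1 →
    (x : W n+1) → χ (H? m) x ≡ ∑χ m x - (+ q) *ℤ ∑χ-pred m x
proposition2 k m n+1 2m≤n+1 x = Forms.χH≡∑χ-∑χ k x m 2m≤n+1
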